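{- Every nondeterministic thrifty $k$-way branching program solving $BT^4_2(k)$ has $\Omega(k^3)$ states (as $k\to\infty$).
   Context: Let $[k]=\{1,\dots,k\}$. $T^4_2$ is the balanced rooted binary tree with 4 levels, nodes numbered heap-style: root $1$, children of node $i$ are $2i,2i+1$. An instance assigns to each internal node $i$ a function $f_i:[k]^2\to[k]$ (given by its $k^2$ values) and to each leaf an element of $[k]$; $v_i$ is the leaf label for a leaf and $v_i=f_i(v_{2i},v_{2i+1})$ otherwise. $BT^4_2(k)$: decide whether $v_1=1$. The $k$-ary input variables are $f_i(a,b)$ ($i$ internal, $a,b\in[k]$) and one per leaf. A nondeterministic $k$-way branching program computing $g:[k]^m\to R$ is a directed rooted multigraph of states; edges are labelled by elements of $[k]$; every state is labelled by a variable index in $[m]$ except $|R|$ final sink states labelled by elements of $R$. On input $x$, edges labelled $x_j$ leaving states labelled $j$ are activated; a computation is a path of activated edges from the root, which is infinite, ends in the final state labelled $g(x)$, or ends at a nonfinal state labelled $j$ with no outedge labelled $x_j$; at least one computation must end in a final state. Such a program solving $BT^4_2(k)$ is thrifty if, for every input, every computation ending in a final state only queries internal-node variables $f_i(a,b)$ with $(a,b)=(v_{2i},v_{2i+1})$. -}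

module Defs where

open import Data.Nat using (ℕ; zero; suc; _≡ᵇ_)
open import Data.Fin using (Fin; toℕ)
open import Data.Bool using (Bool; true; false)
open import Data.Product using (_×_; _,_; Σ; ∃)
open import Data.Sum using (_⊎_; inj₁; inj₂)
open import Data.List using (List; []; _∷_)
open import Data.List.Membership.Propositional using (_∈_)
open import Data.List.Relation.Unary.All using (All)
open import Data.Unit using (⊤)
open import Data.Empty using (⊥)
open import Relation.Binary.PropositionalEquality using (_≡_)

-- The tree T^4_2 (heap numbering): internal nodes 1..7, leaves 8..15.
-- [k] = {1,..,k} is represented by Fin k, with the element 1 ↦ Fin.zero,
-- element j ↦ the Fin with toℕ = j - 1.

data Internal : Set where
  n1 n2 n3 n4 n5 n6 n7 : Internal

data Leaf : Set where
  n8 n9 n10 n11 n12 n13 n14 n15 : Leaf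

-- k-ary input variables of BT^4_2(k):
--   inj₁ (i , a , b)  is  f_i(a,b)  (i internal, a b ∈ [k])
--   inj₂ l            is the label of leaf l
Var : ℕ → Set
Var k = (Internal × Fin k × Fin k) ⊎ Leaf

Input : ℕ → Set
Input k = Var k → Fin k

module _ {k : ℕ} (x : Input k) where

  f : Internal → Fin k → Fin k → Fin k
  f i a b = x (inj₁ (i , a , b))

  leaf : Leaf → Fin k
  leaf l = x (inj₂ l)

  v4 v5 v6 v7 v2 v3 v1 : Fin k
  v4 = f n4 (leaf n8)  (leaf n9)
  v5 = f n5 (leaf n10) (leaf n11)
  v6 = f n6 (leaf n12) (leaf n13)
  v7 = f n7 (leaf n14) (leaf n15)
  v2 = f n2 v4 v5
  v3 = f n3 v6 v7
  v1 = f n1 v2 v3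

  childVals : Internal → Fin k × Fin k
  childVals n1 = v2 , v3
  childVals n2 = v4 , v5
  childVals n3 = v6 , v7
  childVals n4 = leaf n8  , leaf n9
  childVals n5 = leaf n10 , leaf n11
  childVals n6 = leaf n12 , leaf n13
  childVals n7 = leaf n14 , leaf n15

-- BT^4_2(k) : [k]^m → R with R = Bool ; value true iff v_1 = 1
BT : (k : ℕ) → Input k → Bool
BT k x = toℕ (v1 x) ≡ᵇ 0

-- Nondeterministic k-way branching programs for functions Input k → Bool,
-- with state set Fin n.  A state label is  inj₁ j  (nonfinal, queries
-- variable j) or  inj₂ r  (final state labelled r ∈ R = Bool).

record NBP (k n : ℕ) : Set where
  field
    root  : Fin n
    label : Fin n → Var k ⊎ Bool
    -- multigraph edges: (source , edge label ∈ [k] , target)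
    edges : List (Fin n × Fin k × Fin n)
    final        : Bool → Fin n
    final-label  : ∀ r → label (final r) ≡ inj₂ r
    final-unique : ∀ s r → label s ≡ inj₂ r → s ≡ final r
    final-sink   : ∀ s a t r → (s , a , t) ∈ edges → label s ≡ inj₂ r → ⊥

open NBP public

module _ {k n : ℕ} (P : NBP k n) (x : Input k) where

  data Path : Fin n → Fin n → Set where
    []  : ∀ {s} → Path s s
    step : ∀ {s t u} (j : Var k) → label P s ≡ inj₁ j →
           (s , x j , t) ∈ edges P → Path t u → Path s u

  queries : ∀ {s t} → Path s t → List (Var k)
  queries [] = []
  queries (step j _ _ p) = j ∷ queries p

ThriftyQuery : ∀ {k} → Input k → Var k → Set
ThriftyQuery x (inj₁ (i , a , b)) = (a , b) ≡ childVals x i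
ThriftyQuery x (inj₂ _) = ⊤

Computes : ∀ {k n} → NBP k n → (Input k → Bool) → Set
Computes {k} {n} P g = ∀ (x : Input k) →
  (Σ (Fin n) λ t → Σ Bool λ r → label P t ≡ inj₂ r × Path P x (root P) t)
  ×
  (∀ (t : Fin n) (r : Bool) → label P t ≡ inj₂ r → Path P x (root P) t → r ≡ g x)

Thrifty : ∀ {k n} → NBP k n → Set
Thrifty {k} {n} P = ∀ (x : Input k) (t : Fin n) (r : Bool) →
  label P t ≡ inj₂ r → (p : Path P x (root P) t) → All (ThriftyQuery x) (queries P x p)

{-# OPTIONS --safe #-}
module Submission where

-- Consider only inputs whose functions f_i are constant.  Call two states s, s′
-- on a halting computation critical for the nodes i, j if i and
-- j are not queried between s and s′ but their parents are.  Let two inputs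
-- agree outside v_i, v_j and have the same critical states s, s′.  Splicing the
-- part from s to s′ of one computation into the other gives a computation in
-- which the parents of i and j are queried with the wrong arguments, against
-- thriftiness, unless the inputs are equal.
--
-- Critical states that are initial, final, or query a node other than the
-- parents of i and j always exist.  Look at a query of the root and at the last
-- query of another internal node before it.  If that node is not a child of the
-- root, the states there and at the next query of 2 or 3 are critical for 2, 3.
-- Otherwise it is 3, say.  If the last query before it of another internal node
-- is not 6 or 7, then that state and the next query of 6 or 7 are critical for
-- 6, 7; if it is 6, say, then that state and the first query of 2, 6 or 7 after
-- the root are critical for 2, 7.
--
-- Fix all values but v_i, v_j, and let X be the number of states that query a
-- thrifty variable not depending on v_i, v_j (or are initial or final).  At most
-- min(X², k²) ≤ kX choices of v_i, v_j have critical states for i, j.  A state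
-- querying f_q(a,b) is thrifty for only a fraction 1/k² of the inputs, so X is
-- O(n/k²) on average, and k² ≤ O(k · n/k²).

open import Defs
open import Algebra.Properties.CommutativeSemigroup using (interchange)
open import Data.Bool using (Bool; true; false)
open import Data.Empty using (⊥)
open import Data.Fin using (Fin; zero; suc; toℕ; _≟_)
open import Data.Fin.Patterns
open import Data.List using (List; []; _∷_; _++_; map; length; allFin; cartesianProduct; cartesianProductWith)
open import Data.List.Membership.Propositional using (_∈_; _∉_; find; lose)
open import Data.List.Membership.Propositional.Properties using (∈-++⁺ˡ; ∈-++⁺ʳ; ∈-allFin; ∈-cartesianProduct⁺)
open import Data.List.Properties using (map-++; map-∘; map-cong; length-tabulate)
open import Data.List.Relation.Unary.All as All using (All; []; _∷_)
open import Data.List.Relation.Unary.All.Properties using (++⁺; ++⁻ˡ; ++⁻ʳ)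
open import Data.List.Relation.Unary.AllPairs using ([]; _∷_)
open import Data.List.Relation.Unary.Any using (Any; here; there)
open import Data.List.Relation.Unary.Unique.Propositional using (Unique)
open import Data.List.Relation.Unary.Unique.Propositional.Properties using (allFin⁺; cartesianProduct⁺)
open import Data.Maybe using (Maybe; just; nothing)
open import Data.Maybe.Properties using (just-injective)
open import Data.Nat using (ℕ; zero; suc; _≡ᵇ_; _≤_; _+_; _*_; _^_; NonZero; z≤n; s≤s)
open import Data.Nat.ListAction using (sum)
open import Data.Nat.ListAction.Properties using (sum-++)
open import Data.Nat.Properties hiding (_≟_)
open import Data.Nat.Solver using (module +-*-Solver)
open import Data.Product using (Σ; ∃; _×_; _,_; proj₁; proj₂; -,_)
open import Data.Product.Properties using (,-injectiveˡ; ,-injectiveʳ; ≡-dec)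
open import Data.Sum using (_⊎_; inj₁; inj₂)
open import Data.Sum.Properties using (inj₁-injective)
open import Data.Unit using (⊤; tt)
open import Data.Vec using (Vec; []; _∷_; lookup; _[_]≔_)
open import Data.Vec.Properties using (lookup∘update; lookup∘update′)
open import Function using (_∘_; id)
open import Relation.Binary.Definitions using (DecidableEquality)
open import Relation.Binary.PropositionalEquality using (_≡_; _≢_; refl; sym; trans; cong; cong₂; subst; ≢-sym; module ≡-Reasoning)
open import Relation.Nullary using (Dec; yes; no; ¬_; contradiction)
open import Relation.Nullary.Decidable using (map′; ¬?; _×-dec_; _⊎-dec_; _→-dec_; from-yes)
open import Relation.Unary using (Decidable)

-- Finite sums and counting with indicators

private
  variable
    A B C : Set

ind : ∀ {P : Set} → Dec P → ℕ
ind (yes _) = 1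
ind (no  _) = 0

ind-yes : ∀ {P : Set} (P? : Dec P) → P → 1 ≤ ind P?
ind-yes (yes _) _ = ≤-refl
ind-yes (no ¬p) p = contradiction p ¬p

ind≤1 : ∀ {P : Set} (P? : Dec P) → ind P? ≤ 1
ind≤1 (yes _) = ≤-refl
ind≤1 (no  _) = z≤n

ind≤ : ∀ {P : Set} {m} (P? : Dec P) → (P → 1 ≤ m) → ind P? ≤ m
ind≤ (yes p) h = h p
ind≤ (no  _) _ = z≤n

∑ : List A → (A → ℕ) → ℕ
∑ xs f = sum (map f xs)

∑-cong : ∀ (xs : List A) {f g} → (∀ x → f x ≡ g x) → ∑ xs f ≡ ∑ xs g
∑-cong xs f≗g = cong sum (map-cong f≗g xs)

∑-mono : ∀ (xs : List A) {f g} → (∀ x → f x ≤ g x) → ∑ xs f ≤ ∑ xs g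
∑-mono []       f≤g = z≤n
∑-mono (x ∷ xs) f≤g = +-mono-≤ (f≤g x) (∑-mono xs f≤g)

∑-const : ∀ (xs : List A) c → ∑ xs (λ _ → c) ≡ length xs * c
∑-const []       c = refl
∑-const (_ ∷ xs) c = cong (c +_) (∑-const xs c)

∑-Fin : ∀ k c → ∑ (allFin k) (λ _ → c) ≡ k * c
∑-Fin k c = trans (∑-const (allFin k) c) (cong (_* c) (length-tabulate {n = k} (λ i → i)))

∑-+ : ∀ (xs : List A) f g → ∑ xs (λ x → f x + g x) ≡ ∑ xs f + ∑ xs g
∑-+ []       f g = refl
∑-+ (x ∷ xs) f g =
  trans (cong (f x + g x +_) (∑-+ xs f g)) (interchange +-commutativeSemigroup (f x) (g x) (∑ xs f) (∑ xs g))

∑-*ˡ : ∀ c (xs : List A) f → ∑ xs (λ x → c * f x) ≡ c * ∑ xs f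
∑-*ˡ c []       f = sym (*-zeroʳ c)
∑-*ˡ c (x ∷ xs) f = trans (cong (c * f x +_) (∑-*ˡ c xs f)) (sym (*-distribˡ-+ c (f x) (∑ xs f)))

∑-*ʳ : ∀ c (xs : List A) f → ∑ xs (λ x → f x * c) ≡ ∑ xs f * c
∑-*ʳ c xs f = trans (∑-cong xs (λ x → *-comm (f x) c)) (trans (∑-*ˡ c xs f) (*-comm c (∑ xs f)))

∑-swap : ∀ (xs : List A) (ys : List B) (f : A → B → ℕ) →
         ∑ xs (λ x → ∑ ys (f x)) ≡ ∑ ys (λ y → ∑ xs (λ x → f x y))
∑-swap []       ys f = sym (trans (∑-const ys 0) (*-zeroʳ (length ys)))
∑-swap (x ∷ xs) ys f = trans (cong (∑ ys (f x) +_) (∑-swap xs ys f))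
                             (sym (∑-+ ys (f x) (λ y → ∑ xs (λ x → f x y))))

∑-product : ∀ (_⊗_ : A → B → C) xs ys f →
            ∑ (cartesianProductWith _⊗_ xs ys) f ≡ ∑ xs (λ x → ∑ ys (λ y → f (x ⊗ y)))
∑-product _⊗_ []       ys f = refl
∑-product _⊗_ (x ∷ xs) ys f = begin
  sum (map f (map (x ⊗_) ys ++ zs))           ≡⟨ cong sum (map-++ f (map (x ⊗_) ys) zs) ⟩
  sum (map f (map (x ⊗_) ys) ++ map f zs)     ≡⟨ sum-++ (map f (map (x ⊗_) ys)) (map f zs) ⟩
  sum (map f (map (x ⊗_) ys)) + ∑ zs f        ≡⟨ cong₂ _+_ (cong sum (sym (map-∘ ys))) (∑-product _⊗_ xs ys f) ⟩
  ∑ ys (λ y → f (x ⊗ y)) + ∑ xs (λ x → ∑ ys (λ y → f (x ⊗ y))) ∎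
  where
  open ≡-Reasoning
  zs = cartesianProductWith _⊗_ xs ys

term≤∑ : ∀ {xs : List A} {x} f → x ∈ xs → f x ≤ ∑ xs f
term≤∑ f (here refl)           = m≤m+n _ _
term≤∑ f (there {x = y} x∈xs)  = ≤-trans (term≤∑ f x∈xs) (m≤n+m _ (f y))

module _ {P : A → Set} (P? : Decidable P) where

  count-none : ∀ {xs} → All (¬_ ∘ P) xs → ∑ xs (ind ∘ P?) ≡ 0
  count-none []                = refl
  count-none (_∷_ {x} ¬p ¬ps) with P? x
  ... | yes p = contradiction p ¬p
  ... | no  _ = count-none ¬ps

  -- The bound `m` has to be positive only if some element satisfies `P`; it can therefore be a
  -- weight that vanishes on empty fibres.
  count-atMostOne : ∀ {xs m} → Unique xs → (∀ {x y} → P x → P y → x ≡ y) →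
                    (∀ {x} → P x → 1 ≤ m) → ∑ xs (ind ∘ P?) ≤ m
  count-atMostOne []              _   _  = z≤n
  count-atMostOne {x ∷ xs} (x∉xs ∷ uniq) one pos with P? x
  ... | no  _ = count-atMostOne uniq one pos
  ... | yes p = ≤-trans (≤-reflexive (cong suc (count-none (none x∉xs)))) (pos p)
    where
    none : ∀ {ys} → All (x ≢_) ys → All (¬_ ∘ P) ys
    none []           = []
    none (x≢y ∷ x≢ys) = (λ py → x≢y (one p py)) ∷ none x≢ys

-- Split each indicator by the value of `h` and swap the sums: the fibre over `y` then has at most
-- one element satisfying `P`, and `w y` is positive when it has one.
count-injection : DecidableEquality B → ∀ {P : A → Set} (P? : Decidable P) {xs} {ys : List B} {w : B → ℕ}
                  (h : A → B) → Unique xs → (∀ x → h x ∈ ys) →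
                  (∀ {x y} → P x → P y → h x ≡ h y → x ≡ y) → (∀ {x} → P x → 1 ≤ w (h x)) →
                  ∑ xs (ind ∘ P?) ≤ ∑ ys w
count-injection _≟_ P? {xs} {ys} {w} h uniq h∈ inj pos = begin
  ∑ xs (ind ∘ P?)                              ≤⟨ ∑-mono xs spread ⟩
  ∑ xs (λ x → ∑ ys (λ y → ind (hits? y x)))    ≡⟨ ∑-swap xs ys _ ⟩
  ∑ ys (λ y → ∑ xs (λ x → ind (hits? y x)))    ≤⟨ ∑-mono ys fibre ⟩
  ∑ ys w                                       ∎
  where
  open ≤-Reasoning
  hits? = λ y x → P? x ×-dec (h x ≟ y)
  spread : ∀ x → ind (P? x) ≤ ∑ ys (λ y → ind (hits? y x))
  spread x = ind≤ (P? x) λ p →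
    ≤-trans (ind-yes (hits? (h x) x) (p , refl)) (term≤∑ (λ y → ind (hits? y x)) (h∈ x))
  fibre : ∀ y → ∑ xs (λ x → ind (hits? y x)) ≤ w y
  fibre y = count-atMostOne (hits? y) uniq
    (λ (p , hx≡y) (q , hx′≡y) → inj p q (trans hx≡y (sym hx′≡y)))
    (λ { (p , refl) → pos p })

-- The fibres of `h` over `ys` cover `xs`, so a bound on every fibre bounds the whole; it is applied
-- to the kinds of critical pairs.
count-cover : ∀ (_≟_ : DecidableEquality B) (xs : List A) (ys : List B) (h : A → B) → (∀ x → h x ∈ ys) →
              ∀ c b → (∀ y → c * ∑ xs (λ x → ind (h x ≟ y)) ≤ b) →
              c * length xs ≤ length ys * b
count-cover _≟_ xs ys h h∈ c b bound = begin
  c * length xs                                        ≡⟨ cong (c *_) (*-identityʳ _) ⟨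
  c * (length xs * 1)                                  ≡⟨ cong (c *_) (∑-const xs 1) ⟨
  c * ∑ xs (λ _ → 1)                                   ≤⟨ *-monoʳ-≤ c (∑-mono xs covered) ⟩
  c * ∑ xs (λ x → ∑ ys (λ y → ind (h x ≟ y)))          ≡⟨ cong (c *_) (∑-swap xs ys _) ⟩
  c * ∑ ys (λ y → ∑ xs (λ x → ind (h x ≟ y)))          ≡⟨ ∑-*ˡ c ys _ ⟨
  ∑ ys (λ y → c * ∑ xs (λ x → ind (h x ≟ y)))          ≤⟨ ∑-mono ys bound ⟩
  ∑ ys (λ _ → b)                                       ≡⟨ ∑-const ys b ⟩
  length ys * b                                        ∎
  where
  open ≤-Reasoning
  covered : ∀ x → 1 ≤ ∑ ys (λ y → ind (h x ≟ y))
  covered x = ≤-trans (ind-yes (h x ≟ h x) refl) (term≤∑ (λ y → ind (h x ≟ y)) (h∈ x))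

m≤a*a⊓b*b⇒m≤b*a : ∀ {m} a b → m ≤ a * a → m ≤ b * b → m ≤ b * a
m≤a*a⊓b*b⇒m≤b*a a b m≤aa m≤bb with ≤-total a b
... | inj₁ a≤b = ≤-trans m≤aa (*-monoˡ-≤ a a≤b)
... | inj₂ b≤a = ≤-trans m≤bb (*-monoʳ-≤ b b≤a)

-- Each (a , b) is coded by a pair of codewords, so their number is at most
-- X² as well as k², where X is the weight of the code.
count-pairs : ∀ {k n} {P : Fin k × Fin k → Set} (P? : Decidable P) (w : Fin n → ℕ) (h : Fin k × Fin k → Fin n × Fin n) →
              (∀ {x y} → P x → P y → h x ≡ h y → x ≡ y) →
              (∀ {x} → P x → 1 ≤ w (proj₁ (h x)) × 1 ≤ w (proj₂ (h x))) →
              ∑ (allFin k) (λ a → ∑ (allFin k) (λ b → ind (P? (a , b)))) ≤ k * ∑ (allFin n) w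
count-pairs {k} {n} P? w h inj pos = ≤-trans
  (≤-reflexive (sym (∑-product _,_ (allFin k) (allFin k) (ind ∘ P?))))
  (m≤a*a⊓b*b⇒m≤b*a (∑ (allFin n) w) k codes all)
  where
  open ≤-Reasoning
  pairs = λ m → cartesianProduct (allFin m) (allFin m)
  codes : ∑ (pairs k) (ind ∘ P?) ≤ ∑ (allFin n) w * ∑ (allFin n) w
  codes = begin
    ∑ (pairs k) (ind ∘ P?)
      ≤⟨ count-injection (≡-dec _≟_ _≟_) P? h (cartesianProduct⁺ (allFin⁺ k) (allFin⁺ k))
           (λ x → ∈-cartesianProduct⁺ (∈-allFin (proj₁ (h x))) (∈-allFin (proj₂ (h x)))) inj
           (λ p → let l , r = pos p in *-mono-≤ l r) ⟩
    ∑ (pairs n) (λ (s , t) → w s * w t)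
      ≡⟨ ∑-product _,_ (allFin n) (allFin n) _ ⟩
    ∑ (allFin n) (λ s → ∑ (allFin n) (λ t → w s * w t))
      ≡⟨ ∑-cong (allFin n) (λ s → ∑-*ˡ (w s) (allFin n) w) ⟩
    ∑ (allFin n) (λ s → w s * ∑ (allFin n) w)
      ≡⟨ ∑-*ʳ _ (allFin n) w ⟩
    ∑ (allFin n) w * ∑ (allFin n) w ∎
  all : ∑ (pairs k) (ind ∘ P?) ≤ k * k
  all = begin
    ∑ (pairs k) (ind ∘ P?)                       ≤⟨ ∑-mono (pairs k) (ind≤1 ∘ P?) ⟩
    ∑ (pairs k) (λ _ → 1)                        ≡⟨ ∑-product _,_ (allFin k) (allFin k) _ ⟩
    ∑ (allFin k) (λ _ → ∑ (allFin k) (λ _ → 1))  ≡⟨ ∑-Fin k _ ⟩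
    k * ∑ (allFin k) (λ _ → 1)                   ≡⟨ cong (k *_) (trans (∑-Fin k 1) (*-identityʳ k)) ⟩
    k * k                                        ∎

-- Sums over vectors and updates of coordinates

vecs : ∀ k m → List (Vec (Fin k) m)
vecs k zero    = [] ∷ []
vecs k (suc m) = cartesianProductWith _∷_ (allFin k) (vecs k m)

length-vecs : ∀ k m → length (vecs k m) ≡ k ^ m
length-vecs k m = trans (sym (trans (∑-const (vecs k m) 1) (*-identityʳ _))) (go m)
  where
  go : ∀ m → ∑ (vecs k m) (λ _ → 1) ≡ k ^ m
  go zero    = refl
  go (suc m) = trans (∑-product _∷_ (allFin k) (vecs k m) _)
                     (trans (∑-Fin k _) (cong (k *_) (go m)))

-- Every vector arises as `v [ i ]≔ a` in exactly `k` ways, one for each value that was overwritten.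
∑-update : ∀ {k m} (i : Fin m) (F : Vec (Fin k) m → ℕ) →
           ∑ (vecs k m) (λ v → ∑ (allFin k) (λ a → F (v [ i ]≔ a))) ≡ k * ∑ (vecs k m) F
∑-update {k} {suc m} zero F = begin
  ∑ (vecs k (suc m)) (λ v → ∑ (allFin k) (λ a → F (v [ zero ]≔ a)))          ≡⟨ ∑-product _∷_ (allFin k) (vecs k m) _ ⟩
  ∑ (allFin k) (λ _ → ∑ (vecs k m) (λ v → ∑ (allFin k) (λ a → F (a ∷ v))))   ≡⟨ ∑-Fin k _ ⟩
  k * ∑ (vecs k m) (λ v → ∑ (allFin k) (λ a → F (a ∷ v)))                    ≡⟨ cong (k *_) (∑-swap (vecs k m) (allFin k) _) ⟩
  k * ∑ (allFin k) (λ a → ∑ (vecs k m) (λ v → F (a ∷ v)))                    ≡⟨ cong (k *_) (∑-product _∷_ (allFin k) (vecs k m) F) ⟨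
  k * ∑ (vecs k (suc m)) F                                                   ∎
  where open ≡-Reasoning
∑-update {k} {suc m} (suc i) F = begin
  ∑ (vecs k (suc m)) (λ v → ∑ (allFin k) (λ a → F (v [ suc i ]≔ a)))                 ≡⟨ ∑-product _∷_ (allFin k) (vecs k m) _ ⟩
  ∑ (allFin k) (λ x → ∑ (vecs k m) (λ v → ∑ (allFin k) (λ a → F (x ∷ v [ i ]≔ a))))  ≡⟨ ∑-cong (allFin k) (λ x → ∑-update i (F ∘ (x ∷_))) ⟩
  ∑ (allFin k) (λ x → k * ∑ (vecs k m) (λ v → F (x ∷ v)))                            ≡⟨ ∑-*ˡ k (allFin k) _ ⟩
  k * ∑ (allFin k) (λ x → ∑ (vecs k m) (λ v → F (x ∷ v)))                            ≡⟨ cong (k *_) (∑-product _∷_ (allFin k) (vecs k m) F) ⟨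
  k * ∑ (vecs k (suc m)) F                                                           ∎
  where open ≡-Reasoning

∑-update₂ : ∀ {k m} (i j : Fin m) (F : Vec (Fin k) m → ℕ) →
            ∑ (vecs k m) (λ v → ∑ (allFin k) (λ a → ∑ (allFin k) (λ b → F ((v [ i ]≔ a) [ j ]≔ b))))
              ≡ k * k * ∑ (vecs k m) F
∑-update₂ {k} i j F = trans (∑-update i (λ v → ∑ (allFin k) (λ b → F (v [ j ]≔ b))))
                            (trans (cong (k *_) (∑-update j F)) (sym (*-assoc k k _)))

-- Coordinates of the nodes and inputs with constant functions

idx : Internal → Fin 9
idx n1 = 0F
idx n2 = 1F
idx n3 = 2F
idx n4 = 3F
idx n5 = 4F
idx n6 = 5F
idx n7 = 6F

leafIdx : Leaf → Fin 9
leafIdx n8  = 7F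
leafIdx n9  = 8F
leafIdx n10 = 7F
leafIdx n11 = 8F
leafIdx n12 = 7F
leafIdx n13 = 8F
leafIdx n14 = 7F
leafIdx n15 = 8F

childIdx : Internal → Fin 9 × Fin 9
childIdx n1 = 1F , 2F
childIdx n2 = 3F , 4F
childIdx n3 = 5F , 6F
childIdx _  = 7F , 8F

-- A partial inverse of `idx`, undefined at the two leaf coordinates. It yields injectivity of `idx`
-- and separates leaves from internal nodes.
node : Fin 9 → Maybe Internal
node 0F = just n1
node 1F = just n2
node 2F = just n3
node 3F = just n4
node 4F = just n5
node 5F = just n6
node 6F = just n7
node _  = nothing

node-idx : ∀ q → node (idx q) ≡ just q
node-idx n1 = refl
node-idx n2 = refl
node-idx n3 = refl
node-idx n4 = refl
node-idx n5 = refl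
node-idx n6 = refl
node-idx n7 = refl

node-leafIdx : ∀ l → node (leafIdx l) ≡ nothing
node-leafIdx n8  = refl
node-leafIdx n9  = refl
node-leafIdx n10 = refl
node-leafIdx n11 = refl
node-leafIdx n12 = refl
node-leafIdx n13 = refl
node-leafIdx n14 = refl
node-leafIdx n15 = refl

idx-injective : ∀ {p q} → idx p ≡ idx q → p ≡ q
idx-injective {p} {q} eq =
  just-injective (trans (sym (node-idx p)) (trans (cong node eq) (node-idx q)))

leafIdx≢idx : ∀ l q → leafIdx l ≢ idx q
leafIdx≢idx l q eq with trans (sym (node-leafIdx l)) (trans (cong node eq) (node-idx q))
... | ()

_≟ⁱ_ : DecidableEquality Internal
p ≟ⁱ q = map′ idx-injective (cong idx) (idx p ≟ idx q)

childIdx-distinct : ∀ q → proj₁ (childIdx q) ≢ proj₂ (childIdx q)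
childIdx-distinct n1 ()
childIdx-distinct n2 ()
childIdx-distinct n3 ()
childIdx-distinct n4 ()
childIdx-distinct n5 ()
childIdx-distinct n6 ()
childIdx-distinct n7 ()

-- A vector of values v₁, …, v₇, a, b is encoded as the input whose functions
-- fᵢ are constantly vᵢ and whose leaf labels are a, b, a, b, …; so a node value
-- may be changed without affecting any other node value.
coord : ∀ {k} → Var k → Fin 9
coord (inj₁ (q , _)) = idx q
coord (inj₂ l)       = leafIdx l

input : ∀ {k} → Vec (Fin k) 9 → Input k
input v j = lookup v (coord j)

inputChildVals : ∀ {k} → Vec (Fin k) 9 → Internal → Fin k × Fin k
inputChildVals v q = lookup v (proj₁ (childIdx q)) , lookup v (proj₂ (childIdx q))

childVals-input : ∀ {k} (v : Vec (Fin k) 9) q → childVals (input v) q ≡ inputChildVals v q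
childVals-input v n1 = refl
childVals-input v n2 = refl
childVals-input v n3 = refl
childVals-input v n4 = refl
childVals-input v n5 = refl
childVals-input v n6 = refl
childVals-input v n7 = refl

-- Queries that depend on a coordinate or reveal it

Asks : ∀ {k} → List Internal → Var k → Set
Asks Q (inj₁ (q , _)) = q ∈ Q
Asks Q (inj₂ _)       = ⊥

-- Leaf queries pass here, as they do for the negation of `Asks`: they never read the coordinate of
-- an internal node.
AsksOnly : ∀ {k} → List Internal → Var k → Set
AsksOnly Q (inj₁ (q , _)) = q ∈ Q
AsksOnly Q (inj₂ _)       = ⊤

open import Data.List.Membership.DecPropositional _≟ⁱ_ using (_∈?_)

asks? : ∀ {k} Q → Decidable (Asks {k} Q)
asks? Q (inj₁ (q , _)) = q ∈? Q
asks? Q (inj₂ _)       = no id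

-- On encoded inputs the answer to such a query is unaffected by a change of coordinate `i`.
Avoids : ∀ {k} → Fin 9 → Var k → Set
Avoids i j = coord j ≢ i

only⇒avoids : ∀ {k Q i} → i ∉ Q → {j : Var k} → AsksOnly Q j → Avoids (idx i) j
only⇒avoids i∉Q {inj₁ _} q∈Q eq = i∉Q (subst (_∈ _) (idx-injective eq) q∈Q)
only⇒avoids i∉Q {inj₂ l} _   eq = leafIdx≢idx l _ eq

¬asks⇒avoids : ∀ {k Q i} → i ∈ Q → {j : Var k} → ¬ Asks Q j → Avoids (idx i) j
¬asks⇒avoids i∈Q {inj₁ _} ¬q∈Q eq = ¬q∈Q (subst (_∈ _) (sym (idx-injective eq)) i∈Q)
¬asks⇒avoids i∈Q {inj₂ l} _    eq = leafIdx≢idx l _ eq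

Reveals : ∀ {k} → Fin 9 → Var k → Set
Reveals i (inj₁ (q , _)) = proj₁ (childIdx q) ≡ i ⊎ proj₂ (childIdx q) ≡ i
Reveals i (inj₂ _)       = ⊥

-- A thrifty query of a parent of coordinate `i` carries the value there as an argument, so one
-- variable that is thrifty for both inputs carries the value of both.
reveals-agree : ∀ {k i} (v w : Vec (Fin k) 9) (j : Var k) → Reveals i j →
                ThriftyQuery (input v) j → ThriftyQuery (input w) j → lookup v i ≡ lookup w i
reveals-agree v w (inj₁ (q , _)) r tv tw
  with trans (sym (childVals-input v q)) (trans (trans (sym tv) tw) (childVals-input w q)) | r
... | eq | inj₁ refl = ,-injectiveˡ eq
... | eq | inj₂ refl = ,-injectiveʳ eq

-- Then the thrifty variable of `q` stays the same when coordinate `i` changes.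
Hidden : Fin 9 → Internal → Set
Hidden i q = i ≢ proj₁ (childIdx q) × i ≢ proj₂ (childIdx q)

hidden? : ∀ i → Decidable (Hidden i)
hidden? i q = ¬? (i ≟ _) ×-dec ¬? (i ≟ _)

-- Cutting and transporting computations

module _ {k n : ℕ} {P : NBP k n} where

  _++ᵖ_ : ∀ {x s t u} → Path P x s t → Path P x t u → Path P x s u
  []           ++ᵖ q = q
  step j l e p ++ᵖ q = step j l e (p ++ᵖ q)

  infixr 5 _++ᵖ_

  queries-++ : ∀ {x s t u} (p : Path P x s t) (q : Path P x t u) →
               queries P x (p ++ᵖ q) ≡ queries P x p ++ queries P x q
  queries-++ []             q = refl
  queries-++ (step j _ _ p) q = cong (j ∷_) (queries-++ p q)

  transport : ∀ {x y s t} (p : Path P x s t) → All (λ j → x j ≡ y j) (queries P x p) →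
              Σ (Path P y s t) λ p′ → queries P y p′ ≡ queries P x p
  transport []             []         = [] , refl
  transport (step j l e p) (eq ∷ eqs) =
    let p′ , qs = transport p eqs
    in step j l (subst (λ a → (_ , a , _) ∈ edges P) eq e) p′ , cong (j ∷_) qs

  head-query : ∀ {x s t j} → label P s ≡ inj₁ j → label P t ≢ inj₁ j →
               (p : Path P x s t) → j ∈ queries P x p
  head-query ls lt []             = contradiction ls lt
  head-query ls lt (step j l _ _) = here (inj₁-injective (trans (sym ls) l))

  next : ∀ Q {x s t} → Path P x s t → Σ (Fin n) λ u → Σ (Path P x s u) λ p → Path P x u t
         × All (¬_ ∘ Asks Q) (queries P x p)
         × (u ≡ t ⊎ ∃ λ j → label P u ≡ inj₁ j × Asks Q j)
  next Q []             = -, [] , [] , [] , inj₁ refl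
  next Q (step j l e p) with asks? Q j
  ... | yes a = -, [] , step j l e p , [] , inj₂ (j , l , a)
  ... | no ¬a = let u , p₁ , p₂ , ¬as , stop = next Q p
                in u , step j l e p₁ , p₂ , ¬a ∷ ¬as , stop

  -- The tail is searched first, so the cut falls at the last query of an internal node other than
  -- `c`. After the query of `d` at the cut itself, only `c` and leaves are asked.
  prev : ∀ c {x s t} → Path P x s t → Σ (Fin n) λ u → Path P x s u × Σ (Path P x u t) λ p →
         (u ≡ s × All (AsksOnly (c ∷ [])) (queries P x p))
         ⊎ ∃ λ d → ∃ λ ab → label P u ≡ inj₁ (inj₁ (d , ab)) × d ≢ c
                            × All (AsksOnly (d ∷ c ∷ [])) (queries P x p)
  prev c []             = -, [] , [] , inj₁ (refl , [])
  prev c (step j l e p) with prev c p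
  ... | u , p₁ , p₂ , inj₂ found = u , step j l e p₁ , p₂ , inj₂ found
  prev c (step (inj₂ f) l e p) | _ , _ , p₂ , inj₁ (refl , only) =
    -, [] , step (inj₂ f) l e p₂ , inj₁ (refl , tt ∷ only)
  prev c (step (inj₁ (d , ab)) l e p) | _ , _ , p₂ , inj₁ (refl , only) with d ≟ⁱ c
  ... | yes refl = -, [] , step _ l e p₂ , inj₁ (refl , here refl ∷ only)
  ... | no d≢c   = -, [] , step _ l e p₂ , inj₂ (d , ab , l , d≢c , here refl ∷ All.map (λ {j} → weaken {j}) only)
    where
    weaken : ∀ {j : Var k} → AsksOnly (c ∷ []) j → AsksOnly (d ∷ c ∷ []) j
    weaken {inj₁ _} = there
    weaken {inj₂ _} = id

-- Combinatorial conditions on the nodes of the tree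

HiddenFrom : Internal → Internal → Internal → Set
HiddenFrom i j q = Hidden (idx i) q × Hidden (idx j) q

hiddenFrom? : ∀ i j → Decidable (HiddenFrom i j)
hiddenFrom? i j q = hidden? (idx i) q ×-dec hidden? (idx j) q

internals : List Internal
internals = n1 ∷ n2 ∷ n3 ∷ n4 ∷ n5 ∷ n6 ∷ n7 ∷ []

∈-internals : ∀ q → q ∈ internals
∈-internals n1 = here refl
∈-internals n2 = there (here refl)
∈-internals n3 = there (there (here refl))
∈-internals n4 = there (there (there (here refl)))
∈-internals n5 = there (there (there (there (here refl))))
∈-internals n6 = there (there (there (there (there (here refl)))))
∈-internals n7 = there (there (there (there (there (there (here refl))))))

-- Since only the thrifty variable of `c` depends on the values of `i` and `j`, a state that asks
-- any other internal node can bound a critical segment. The conditions are decidable and get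
-- checked by evaluation.
Family : Internal → Internal → Internal → Set
Family c i j = i ≢ j × i ≢ c × j ≢ c × childIdx c ≡ (idx i , idx j)
               × All (λ q → q ≢ c → HiddenFrom i j q) internals

family? : ∀ c i j → Dec (Family c i j)
family? c i j = ¬? (i ≟ⁱ j) ×-dec ¬? (i ≟ⁱ c) ×-dec ¬? (j ≟ⁱ c) ×-dec ≡-dec _≟_ _≟_ _ _
                ×-dec All.all? (λ q → ¬? (q ≟ⁱ c) →-dec hiddenFrom? i j q) internals

-- The side conditions of the last case, for {c , sib} = {2 , 3} and {d , e} the
-- children of c.
Corner : Internal → Internal → Internal → Internal → Set
Corner c sib d e =
  sib ≢ e × c ≢ n1 × n1 ∉ Q × sib ∉ d ∷ c ∷ [] × sib ∉ c ∷ n1 ∷ [] × e ∉ d ∷ c ∷ [] × e ∉ c ∷ n1 ∷ []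
  × HiddenFrom sib e d × All (HiddenFrom sib e) Q
  × (proj₁ (childIdx n1) ≡ idx sib ⊎ proj₂ (childIdx n1) ≡ idx sib)
  × (proj₁ (childIdx c) ≡ idx e ⊎ proj₂ (childIdx c) ≡ idx e)
  where Q = sib ∷ d ∷ e ∷ []

corner? : ∀ c sib d e → Dec (Corner c sib d e)
corner? c sib d e =
  ¬? (sib ≟ⁱ e) ×-dec ¬? (c ≟ⁱ n1) ×-dec ¬? (_ ∈? _) ×-dec ¬? (_ ∈? _) ×-dec ¬? (_ ∈? _)
  ×-dec ¬? (_ ∈? _) ×-dec ¬? (_ ∈? _) ×-dec hiddenFrom? sib e d ×-dec All.all? (hiddenFrom? sib e) _
  ×-dec (_ ≟ _ ⊎-dec _ ≟ _) ×-dec (_ ≟ _ ⊎-dec _ ≟ _)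

-- Critical states and splicing

module _ {k n : ℕ} {P : NBP k n} (thrifty : Thrifty P) where

  AsksAt : Internal → Fin n → Set
  AsksAt q s = ∃ λ ab → label P s ≡ inj₁ (inj₁ (q , ab))

  -- These are the states counted by X: apart from initial and final states, they can be recognised
  -- without the values at `i` and `j`.
  Known : Vec (Fin k) 9 → Fin 9 → Fin 9 → Fin n → Set
  Known v i j s = s ≡ root P ⊎ (∃ λ r → s ≡ final P r)
    ⊎ ∃ λ q → label P s ≡ inj₁ (inj₁ (q , inputChildVals v q)) × Hidden i q × Hidden j q

  -- The paths `before` and `after` place the segment inside a halting computation, the only kind
  -- that thriftiness constrains.
  record Critical (v : Vec (Fin k) 9) (i j : Fin 9) (s s′ : Fin n) : Set where
    field
      {target}       : Fin n
      {output}       : Bool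
      target-label   : label P target ≡ inj₂ output
      before         : Path P (input v) (root P) s
      between        : Path P (input v) s s′
      after          : Path P (input v) s′ target
      avoidsˡ        : All (Avoids i) (queries P (input v) between)
      avoidsʳ        : All (Avoids j) (queries P (input v) between)
      revealsˡ       : Any (Reveals i) (queries P (input v) between)
      revealsʳ       : Any (Reveals j) (queries P (input v) between)
      known          : Known v i j s
      known′         : Known v i j s′

  thrifty-between : ∀ {x s t u r} → label P u ≡ inj₂ r → Path P x (root P) s →
                    (p : Path P x s t) → Path P x t u → All (ThriftyQuery x) (queries P x p)
  thrifty-between {x} l a p b = ++⁻ˡ _ (subst (All _) (queries-++ p b)
    (++⁻ʳ (queries P x a) (subst (All _) (queries-++ a (p ++ᵖ b)) (thrifty x _ _ l (a ++ᵖ p ++ᵖ b)))))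

  -- Splicing the middle part of the computation on w into the one on v gives a
  -- computation on v, whose thriftiness forces the values in w to be those of v.
  critical-agree : ∀ {v w i j s s′} → Critical v i j s s′ → Critical w i j s s′ →
                   (∀ c → c ≢ i → c ≢ j → lookup w c ≡ lookup v c) →
                   lookup v i ≡ lookup w i × lookup v j ≡ lookup w j
  critical-agree {v} {w} {i} {j} {s} {s′} V W agree =
    value W.revealsˡ , value W.revealsʳ
    where
    module V = Critical V
    module W = Critical W

    spliced : Σ (Path P (input v) s s′) λ p → queries P (input v) p ≡ queries P (input w) W.between
    spliced = transport W.between
      (All.zipWith (λ {q} (ai , aj) → agree (coord q) ai aj) (W.avoidsˡ , W.avoidsʳ))

    thrifty-v : All (ThriftyQuery (input v)) (queries P (input w) W.between)
    thrifty-v = subst (All _) (proj₂ spliced)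
      (thrifty-between V.target-label V.before (proj₁ spliced) V.after)

    thrifty-w : All (ThriftyQuery (input w)) (queries P (input w) W.between)
    thrifty-w = thrifty-between W.target-label W.before W.between W.after

    value : ∀ {c} → Any (Reveals c) (queries P (input w) W.between) → lookup v c ≡ lookup w c
    value revealed with find revealed
    ... | q , q∈ , r = reveals-agree v w q r (All.lookup thrifty-v q∈) (All.lookup thrifty-w q∈)

  -- Distinctness of `i` and `j` lets `count-fibre` read back both values after two successive
  -- updates.
  CriticalAt : Vec (Fin k) 9 → Fin 9 × Fin 9 → Fin n × Fin n → Set
  CriticalAt v (i , j) (s , s′) = i ≢ j × Critical v i j s s′

  HasCritical : Vec (Fin k) 9 → Set
  HasCritical v = ∃ λ ij → ∃ λ ss′ → CriticalAt v ij ss′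

  -- Existence of critical states

  module _ (v : Vec (Fin k) 9) {t : Fin n} {r : Bool} (t-final : label P t ≡ inj₂ r) where

    private
      x = input v

    t-asks-nothing : ∀ y → label P t ≢ inj₁ y
    t-asks-nothing y l with trans (sym t-final) l
    ... | ()

    t-known : ∀ {i j} → Known v i j t
    t-known = inj₂ (inj₁ (r , final-unique P t r t-final))

    -- The final state asks nothing, so the rest of the computation begins with the query at `s`,
    -- and thriftiness applies to it.
    asking-thrifty : ∀ {q s} → Path P x (root P) s → Path P x s t → AsksAt q s →
                     label P s ≡ inj₁ (inj₁ (q , inputChildVals v q))
    asking-thrifty {q} a b (ab , l) = trans l (cong (λ p → inj₁ (inj₁ (q , p))) (trans
      (All.lookup (thrifty-between t-final a b []) (head-query l (t-asks-nothing _) b)) (childVals-input v q)))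

    asking-known : ∀ {i j q s} → Path P x (root P) s → Path P x s t → AsksAt q s →
                   HiddenFrom i j q → Known v (idx i) (idx j) s
    asking-known {q = q} a b s-asks hid = inj₂ (inj₂ (q , asking-thrifty a b s-asks , hid))

    stop-known : ∀ {i j Q s} → Path P x (root P) s → Path P x s t →
                 s ≡ t ⊎ (∃ λ y → label P s ≡ inj₁ y × Asks Q y) →
                 All (HiddenFrom i j) Q → Known v (idx i) (idx j) s
    stop-known a b (inj₁ refl) hid = t-known
    stop-known a b (inj₂ (inj₁ (q , ab) , l , q∈Q)) hid = asking-known a b (ab , l) (All.lookup hid q∈Q)

    stop-other : ∀ {Q s c ab} → s ≡ t ⊎ (∃ λ y → label P s ≡ inj₁ y × Asks Q y) →
                 c ∉ Q → label P s ≢ inj₁ (inj₁ (c , ab))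
    stop-other (inj₁ refl) _ = t-asks-nothing _
    stop-other (inj₂ (y , l , a)) c∉Q l′ with trans (sym l) l′
    ... | refl = c∉Q a

    -- The candidate segment runs from the last query of another internal node before `z`, or from
    -- the root state, to the next query of `i` or `j`, or to the end. It asks `c` at `z`, and it
    -- avoids `i` and `j` unless it starts at one of them, which is the second alternative.
    preceded : ∀ {c i j z} → Family c i j → AsksAt c z → Path P x (root P) z → Path P x z t →
               HasCritical v ⊎
               ∃ λ d → d ∈ i ∷ j ∷ [] × ∃ λ u → AsksAt d u × Path P x (root P) u ×
                 Σ (Path P x u z) λ p → All (AsksOnly (d ∷ c ∷ [])) (queries P x p)
    preceded {c} {i} {j} {z} (i≢j , i≢c , j≢c , children , hid) (ab , lz) a b
      with prev c a | next (i ∷ j ∷ []) b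
    ... | u , a₁ , p , from | w , p′ , b₁ , ¬as , stop = decide from
      where
      module _ {Q} (only : All (AsksOnly Q) (queries P x p)) (i∉ : i ∉ Q) (j∉ : j ∉ Q)
               (kn : Known v (idx i) (idx j) u) where
        revealing : ∀ {m} → Reveals {k} m (inj₁ (c , ab)) → Any (Reveals m) (queries P x (p ++ᵖ p′))
        -- The stopping state asks `i` or `j` or is final, so it differs from `z`, and `p′` begins
        -- with the query of `c`.
        revealing rev = lose (subst (_ ∈_) (sym (queries-++ p p′)) (∈-++⁺ʳ (queries P x p)
          (head-query lz (stop-other stop λ { (here e) → i≢c (sym e) ; (there (here e)) → j≢c (sym e) }) p′))) rev

        avoiding : ∀ {m} → m ∉ Q → m ∈ i ∷ j ∷ [] → All (Avoids (idx m)) (queries P x (p ++ᵖ p′))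
        avoiding m∉ m∈ = subst (All _) (sym (queries-++ p p′))
          (++⁺ (All.map (λ {y} → only⇒avoids m∉ {y}) only) (All.map (λ {y} → ¬asks⇒avoids m∈ {y}) ¬as))

        critical : HasCritical v
        critical = (idx i , idx j) , (u , w) , i≢j ∘ idx-injective , record
          { target-label = t-final
          ; before   = a₁
          ; between  = p ++ᵖ p′
          ; after    = b₁
          ; avoidsˡ  = avoiding i∉ (here refl)
          ; avoidsʳ  = avoiding j∉ (there (here refl))
          ; revealsˡ = revealing (inj₁ (cong proj₁ children))
          ; revealsʳ = revealing (inj₂ (cong proj₂ children))
          ; known    = kn
          ; known′   = stop-known (a₁ ++ᵖ p ++ᵖ p′) b₁ stop
                         (All.lookup hid (∈-internals i) i≢c ∷ All.lookup hid (∈-internals j) j≢c ∷ [])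
          }

      decide : _ → _
      decide (inj₁ (u≡root , only)) =
        inj₁ (critical only (λ { (here e) → i≢c e }) (λ { (here e) → j≢c e }) (inj₁ u≡root))
      decide (inj₂ (d , cd , lu , d≢c , only)) with d ∈? (i ∷ j ∷ [])
      ... | yes d∈ = inj₂ (d , d∈ , u , (cd , lu) , a₁ , p , only)
      ... | no  d∉ = inj₁ (critical only
              (λ { (here e) → d∉ (here (sym e)) ; (there (here e)) → i≢c e })
              (λ { (here e) → d∉ (there (here (sym e))) ; (there (here e)) → j≢c e })
              (asking-known a₁ (p ++ᵖ b) (cd , lu) (All.lookup hid (∈-internals d) d≢c)))

    -- The segment starts by asking `d`, which rules out the pair `d`, `e`. Extending it past the
    -- query of the root replaces `d` by `sib`, revealed at `g`, while `e` is revealed at `z`.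
    corner : ∀ {c sib d e u z g} → Corner c sib d e → AsksAt d u → AsksAt c z → AsksAt n1 g →
             Path P x (root P) u →
             (p₁ : Path P x u z) → All (AsksOnly (d ∷ c ∷ [])) (queries P x p₁) →
             (p₂ : Path P x z g) → All (AsksOnly (c ∷ n1 ∷ [])) (queries P x p₂) →
             Path P x g t → HasCritical v
    corner {c} {sib} {d} {e} {u} {z} {g} (sib≢e , c≢n1 , n1∉ , sib∉₁ , sib∉₂ , e∉₁ , e∉₂ , hid-d , hid-Q , rev-sib , rev-e)
           u-asks (cab , lz) (gab , lg) a p₁ only₁ p₂ only₂ b
      with next (sib ∷ d ∷ e ∷ []) b
    ... | w , p₃ , b₁ , ¬as , stop = (idx sib , idx e) , (u , w) , sib≢e ∘ idx-injective , record
      { target-label = t-final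
      ; before   = a
      ; between  = p₁ ++ᵖ p₂ ++ᵖ p₃
      ; after    = b₁
      ; avoidsˡ  = avoiding sib∉₁ sib∉₂ (here refl)
      ; avoidsʳ  = avoiding e∉₁ e∉₂ (there (there (here refl)))
      ; revealsˡ = lose (in-between (∈-++⁺ʳ (queries P x p₂) g∈)) rev-sib
      ; revealsʳ = lose (in-between (∈-++⁺ˡ z∈)) rev-e
      ; known    = asking-known a (p₁ ++ᵖ p₂ ++ᵖ b) u-asks hid-d
      ; known′   = stop-known (a ++ᵖ p₁ ++ᵖ p₂ ++ᵖ p₃) b₁ stop hid-Q
      }
      where
      queries-between : queries P x (p₁ ++ᵖ p₂ ++ᵖ p₃) ≡ queries P x p₁ ++ queries P x p₂ ++ queries P x p₃
      queries-between = trans (queries-++ p₁ (p₂ ++ᵖ p₃)) (cong (queries P x p₁ ++_) (queries-++ p₂ p₃))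

      in-between : ∀ {y} → y ∈ queries P x p₂ ++ queries P x p₃ → y ∈ queries P x (p₁ ++ᵖ p₂ ++ᵖ p₃)
      in-between y∈ = subst (_ ∈_) (sym queries-between) (∈-++⁺ʳ (queries P x p₁) y∈)

      z∈ : inj₁ (c , cab) ∈ queries P x p₂
      z∈ = head-query lz (λ l → c≢n1 (sym (,-injectiveˡ (inj₁-injective (inj₁-injective (trans (sym lg) l)))))) p₂

      g∈ : inj₁ (n1 , gab) ∈ queries P x p₃
      g∈ = head-query lg (stop-other stop n1∉) p₃

      avoiding : ∀ {m} → m ∉ d ∷ c ∷ [] → m ∉ c ∷ n1 ∷ [] → m ∈ sib ∷ d ∷ e ∷ [] →
                 All (Avoids (idx m)) (queries P x (p₁ ++ᵖ p₂ ++ᵖ p₃))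
      avoiding m∉₁ m∉₂ m∈ = subst (All _) (sym queries-between)
        (++⁺ (All.map (λ {y} → only⇒avoids m∉₁ {y}) only₁)
        (++⁺ (All.map (λ {y} → only⇒avoids m∉₂ {y}) only₂)
             (All.map (λ {y} → ¬asks⇒avoids m∈ {y}) ¬as)))

    critical-around : ∀ {g} → AsksAt n1 g → Path P x (root P) g → Path P x g t → HasCritical v
    critical-around g-asks a b with preceded (from-yes (family? n1 n2 n3)) g-asks a b
    ... | inj₁ crit = crit
    ... | inj₂ (_ , here refl , z , z-asks , a₁ , p , only)
      with preceded (from-yes (family? n2 n4 n5)) z-asks a₁ (p ++ᵖ b)
    ...   | inj₁ crit = crit
    ...   | inj₂ (_ , here refl , u , u-asks , a₂ , p₁ , only₁) =
            corner (from-yes (corner? n2 n3 n4 n5)) u-asks z-asks g-asks a₂ p₁ only₁ p only b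
    ...   | inj₂ (_ , there (here refl) , u , u-asks , a₂ , p₁ , only₁) =
            corner (from-yes (corner? n2 n3 n5 n4)) u-asks z-asks g-asks a₂ p₁ only₁ p only b
    critical-around g-asks a b | inj₂ (_ , there (here refl) , z , z-asks , a₁ , p , only)
      with preceded (from-yes (family? n3 n6 n7)) z-asks a₁ (p ++ᵖ b)
    ...   | inj₁ crit = crit
    ...   | inj₂ (_ , here refl , u , u-asks , a₂ , p₁ , only₁) =
            corner (from-yes (corner? n3 n2 n6 n7)) u-asks z-asks g-asks a₂ p₁ only₁ p only b
    ...   | inj₂ (_ , there (here refl) , u , u-asks , a₂ , p₁ , only₁) =
            corner (from-yes (corner? n3 n2 n7 n6)) u-asks z-asks g-asks a₂ p₁ only₁ p only b

-- Every halting computation queries the root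

switch : ∀ {m} → Fin (suc (suc m)) → Fin (suc (suc m))
switch zero    = suc zero
switch (suc _) = zero

switch-zero : ∀ {m} (a : Fin (suc (suc m))) → (toℕ a ≡ᵇ 0) ≢ (toℕ (switch a) ≡ᵇ 0)
switch-zero zero    ()
switch-zero (suc _) ()

module _ {m n : ℕ} {P : NBP (suc (suc m)) n} (computes : Computes P (BT (suc (suc m)))) (thrifty : Thrifty P) where

  -- A halting computation that never asks `n1` is also one on the input whose root value is changed
  -- by `switch`, where the correct answer is the opposite.
  root-queried : ∀ v → Σ (Fin n) λ t → Σ Bool λ r → Σ (label P t ≡ inj₂ r) λ l → Σ (Fin n) λ g →
                 AsksAt thrifty n1 g × Path P (input v) (root P) g × Path P (input v) g t
  root-queried v with computes (input v)
  ... | (t , r , l , p) , sound with next (n1 ∷ []) p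
  ...   | g , p₁ , p₂ , _ , inj₂ (inj₁ (_ , ab) , lg , here refl) = t , r , l , g , (ab , lg) , p₁ , p₂
  ...   | .t , p₁ , _ , ¬as , inj₁ refl = contradiction
      (trans (sym (sound t r l p₁)) (trans (proj₂ (computes (input w)) t r l (proj₁ (transport p₁ unchanged)))
             (cong (λ a → toℕ a ≡ᵇ 0) (lookup∘update 0F v _))))
      (switch-zero (lookup v 0F))
    where
    w = v [ 0F ]≔ switch (lookup v 0F)
    unchanged : All (λ j → input v j ≡ input w j) (queries P (input v) p₁)
    unchanged = All.map (λ {j} ¬a → sym (lookup∘update′ (¬asks⇒avoids (here refl) {j} ¬a) v _)) ¬as

  critical : ∀ v → HasCritical thrifty v
  critical v = let _ , _ , l , _ , g-asks , a , b = root-queried v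
               in critical-around thrifty v l g-asks a b

  rootState : ∀ v → Σ (Fin n) λ g → label P g ≡ inj₁ (inj₁ (n1 , inputChildVals v n1))
  rootState v = let _ , _ , l , g , g-asks , a , b = root-queried v
                in g , asking-thrifty thrifty v l a b g-asks

-- Averaging the thrifty queries over all inputs

asking : ∀ {k} → Vec (Fin k) 9 → Var k ⊎ Bool → ℕ
asking v (inj₁ (inj₁ (q , ab))) = ind (≡-dec _≟_ _≟_ (inputChildVals v q) ab)
-- Leaf queries count zero, since `Known` does not rely on them.
asking v (inj₁ (inj₂ _))        = 0
asking v (inj₂ _)               = 0

asking-yes : ∀ {k} (v : Vec (Fin k) 9) {l} q → l ≡ inj₁ (inj₁ (q , inputChildVals v q)) → 1 ≤ asking v l
asking-yes v q refl = ind-yes (≡-dec _≟_ _≟_ (inputChildVals v q) _) refl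

lookup-update₂ˡ : ∀ {A : Set} {m} {i j : Fin m} (v : Vec A m) {a b} → i ≢ j → lookup ((v [ i ]≔ a) [ j ]≔ b) i ≡ a
lookup-update₂ˡ {i = i} v {a} i≢j = trans (lookup∘update′ i≢j (v [ i ]≔ a) _) (lookup∘update i v a)

lookup-update₂′ : ∀ {A : Set} {m} {i j c : Fin m} (v : Vec A m) {a b} → c ≢ i → c ≢ j →
                  lookup ((v [ i ]≔ a) [ j ]≔ b) c ≡ lookup v c
lookup-update₂′ {i = i} v {a} c≢i c≢j = trans (lookup∘update′ c≢j (v [ i ]≔ a) _) (lookup∘update′ c≢i v a)

∑-zero : ∀ k → k * k * ∑ (vecs k 9) (λ _ → 0) ≤ k ^ 9
∑-zero k = ≤-trans (≤-reflexive (trans (cong (k * k *_) (trans (∑-const (vecs k 9) 0) (*-zeroʳ (length (vecs k 9)))))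
                                       (*-zeroʳ (k * k)))) z≤n

-- With the other coordinates fixed, at most one choice of the two child coordinates, which are
-- distinct, matches the arguments of the query.
∑-asking : ∀ {k} l → k * k * ∑ (vecs k 9) (λ v → asking v l) ≤ k ^ 9
∑-asking {k} (inj₁ (inj₁ (q , ab))) = begin
  k * k * ∑ (vecs k 9) (λ v → ind (match? v))    ≡⟨ ∑-update₂ c d (λ v → ind (match? v)) ⟨
  ∑ (vecs k 9) (λ v → ∑ (allFin k) (λ a → ∑ (allFin k) (λ b → ind (match? ((v [ c ]≔ a) [ d ]≔ b)))))
    ≤⟨ ∑-mono (vecs k 9) one ⟩
  ∑ (vecs k 9) (λ _ → 1)                         ≡⟨ ∑-const (vecs k 9) 1 ⟩
  length (vecs k 9) * 1                          ≡⟨ *-identityʳ _ ⟩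
  length (vecs k 9)                              ≡⟨ length-vecs k 9 ⟩
  k ^ 9                                          ∎
  where
  open ≤-Reasoning
  c = proj₁ (childIdx q)
  d = proj₂ (childIdx q)
  match? = λ v → ≡-dec _≟_ _≟_ (inputChildVals v q) ab
  values : ∀ v {xy : Fin k × Fin k} → inputChildVals ((v [ c ]≔ proj₁ xy) [ d ]≔ proj₂ xy) q ≡ xy
  values v = cong₂ _,_ (lookup-update₂ˡ v (childIdx-distinct q)) (lookup∘update d (v [ c ]≔ _) _)
  one : ∀ v → ∑ (allFin k) (λ a → ∑ (allFin k) (λ b → ind (match? ((v [ c ]≔ a) [ d ]≔ b)))) ≤ 1
  one v = ≤-trans (≤-reflexive (sym (∑-product _,_ (allFin k) (allFin k) _)))
    (count-atMostOne (λ xy → match? ((v [ c ]≔ proj₁ xy) [ d ]≔ proj₂ xy))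
      (cartesianProduct⁺ (allFin⁺ k) (allFin⁺ k))
      (λ p p′ → trans (sym (values v)) (trans (trans p (sym p′)) (values v)))
      (λ _ → ≤-refl))
∑-asking {k} (inj₁ (inj₂ _)) = ∑-zero k
∑-asking {k} (inj₂ _)        = ∑-zero k

count-point : ∀ {n} (c : Fin n) → ∑ (allFin n) (λ s → ind (s ≟ c)) ≤ 1
count-point {n} c = count-atMostOne (_≟ c) (allFin⁺ n) (λ p q → trans p (sym q)) (λ _ → ≤-refl)

-- 81 bounds the number of pairs of coordinates; 4 y pays for the initial state,
-- the two final states and the querying states.
cancel-powers : ∀ k n y z → k * k * z ≤ 81 * (k * (4 * y)) → k * k * y ≤ n * z →
                k ^ 3 * (k * z) ≤ 324 * n * (k * z)
cancel-powers k n y z z≤ y≤ = begin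
  k ^ 3 * (k * z)             ≡⟨ solve 2 (λ k z → k :^ 3 :* (k :* z) := k :* k :* (k :* k :* z)) refl k z ⟩
  k * k * (k * k * z)         ≤⟨ *-monoʳ-≤ (k * k) z≤ ⟩
  k * k * (81 * (k * (4 * y)))
    ≡⟨ solve 2 (λ k y → k :* k :* (con 81 :* (k :* (con 4 :* y))) := con 324 :* k :* (k :* k :* y)) refl k y ⟩
  324 * k * (k * k * y)       ≤⟨ *-monoʳ-≤ (324 * k) y≤ ⟩
  324 * k * (n * z)           ≡⟨ solve 3 (λ k n z → con 324 :* k :* (n :* z) := con 324 :* n :* (k :* z)) refl k n z ⟩
  324 * n * (k * z)           ∎
  where
  open ≤-Reasoning
  open +-*-Solver

-- Counting critical pairs and the lower bound

module _ {k n : ℕ} {P : NBP k n} (thrifty : Thrifty P) (critical : ∀ v → HasCritical thrifty v)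
         (rootState : ∀ v → Σ (Fin n) λ g → label P g ≡ inj₁ (inj₁ (n1 , inputChildVals v n1))) where

  asked : Vec (Fin k) 9 → ℕ
  asked v = ∑ (allFin n) (λ s → asking v (label P s))

  -- Thanks to the query of the root, the initial state and the two final states each cost at most
  -- `asked v` in `∑-weight`.
  1≤asked : ∀ v → 1 ≤ asked v
  1≤asked v = let g , l = rootState v in
    ≤-trans (asking-yes v n1 l) (term≤∑ (λ s → asking v (label P s)) (∈-allFin g))

  ∑-asked : k * k * ∑ (vecs k 9) asked ≤ n * k ^ 9
  ∑-asked = begin
    k * k * ∑ (vecs k 9) asked
      ≡⟨ cong (k * k *_) (∑-swap (vecs k 9) (allFin n) (λ v s → asking v (label P s))) ⟩
    k * k * ∑ (allFin n) (λ s → ∑ (vecs k 9) (λ v → asking v (label P s)))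
      ≡⟨ ∑-*ˡ (k * k) (allFin n) (λ s → ∑ (vecs k 9) (λ v → asking v (label P s))) ⟨
    ∑ (allFin n) (λ s → k * k * ∑ (vecs k 9) (λ v → asking v (label P s)))
      ≤⟨ ∑-mono (allFin n) (λ s → ∑-asking (label P s)) ⟩
    ∑ (allFin n) (λ _ → k ^ 9)
      ≡⟨ ∑-Fin n (k ^ 9) ⟩
    n * k ^ 9 ∎
    where open ≤-Reasoning

  weight : Vec (Fin k) 9 → Fin n → ℕ
  weight v s = ind (s ≟ root P) + (ind (s ≟ final P true) + (ind (s ≟ final P false) + asking v (label P s)))

  ∑-weight : ∀ v → ∑ (allFin n) (weight v) ≤ 4 * asked v
  ∑-weight v = begin
    ∑ (allFin n) (weight v)
      ≡⟨ trans (∑-+ (allFin n) _ _) (cong (at (root P) +_)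
          (trans (∑-+ (allFin n) _ _) (cong (at (final P true) +_) (∑-+ (allFin n) _ _)))) ⟩
    at (root P) + (at (final P true) + (at (final P false) + asked v))
      ≤⟨ +-mono-≤ (bound (root P)) (+-mono-≤ (bound (final P true)) (+-monoˡ-≤ _ (bound (final P false)))) ⟩
    asked v + (asked v + (asked v + asked v))
      ≡⟨ cong (λ z → asked v + (asked v + (asked v + z))) (sym (+-identityʳ _)) ⟩
    4 * asked v ∎
    where
    open ≤-Reasoning
    at = λ c → ∑ (allFin n) (λ s → ind (s ≟ c))
    bound : ∀ c → at c ≤ asked v
    bound c = ≤-trans (count-point c) (1≤asked v)

  -- The child values of `q` lie outside the overwritten coordinates, so the weight taken at `v`
  -- serves all modifications of `v` at `i` and `j`.
  known⇒weight : ∀ {i j a b s} v → Known thrifty ((v [ i ]≔ a) [ j ]≔ b) i j s → 1 ≤ weight v s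
  known⇒weight {s = s} v (inj₁ e) = ≤-trans (ind-yes (s ≟ root P) e) (m≤m+n _ _)
  known⇒weight {s = s} v (inj₂ (inj₁ (true , e))) =
    ≤-trans (≤-trans (ind-yes (s ≟ final P true) e) (m≤m+n _ _)) (m≤n+m _ (ind (s ≟ root P)))
  known⇒weight {s = s} v (inj₂ (inj₁ (false , e))) =
    ≤-trans (≤-trans (≤-trans (ind-yes (s ≟ final P false) e) (m≤m+n _ _))
                     (m≤n+m _ (ind (s ≟ final P true)))) (m≤n+m _ (ind (s ≟ root P)))
  known⇒weight {i} {j} {s = s} v (inj₂ (inj₂ (q , l , (i≢c , i≢d) , (j≢c , j≢d)))) =
    ≤-trans (≤-trans (≤-trans (asking-yes v q (trans l (cong (λ ab → inj₁ (inj₁ (q , ab))) unchanged)))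
                     (m≤n+m _ (ind (s ≟ final P false))))
                     (m≤n+m _ (ind (s ≟ final P true)))) (m≤n+m _ (ind (s ≟ root P)))
    where
    unchanged : inputChildVals ((v [ i ]≔ _) [ j ]≔ _) q ≡ inputChildVals v q
    unchanged = cong₂ _,_ (lookup-update₂′ v (≢-sym i≢c) (≢-sym j≢c)) (lookup-update₂′ v (≢-sym i≢d) (≢-sym j≢d))

  kind : Vec (Fin k) 9 → Fin 9 × Fin 9
  kind v = proj₁ (critical v)

  kind? : ∀ ij v → Dec (kind v ≡ ij)
  kind? ij v = ≡-dec _≟_ _≟_ (kind v) ij

  code : Vec (Fin k) 9 → Fin n × Fin n
  code v = proj₁ (proj₂ (critical v))

  critical-of-kind : ∀ {ij v} → kind v ≡ ij → CriticalAt thrifty v ij (code v)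
  critical-of-kind {v = v} e = subst (λ ij → CriticalAt thrifty v ij (code v)) e
    (proj₂ (proj₂ (critical v)))

  -- By `critical-agree` the two critical states determine the values at `i` and `j`, and both
  -- states have positive weight.
  count-fibre : ∀ i j v →
    ∑ (allFin k) (λ a → ∑ (allFin k) (λ b → ind (kind? (i , j) ((v [ i ]≔ a) [ j ]≔ b)))) ≤ k * ∑ (allFin n) (weight v)
  count-fibre i j v = count-pairs (λ ab → kind? (i , j) (u ab)) (weight v) (code ∘ u) injective
    (λ p → let _ , C = critical-of-kind p
           in known⇒weight v (Critical.known C) , known⇒weight v (Critical.known′ C))
    where
    u : Fin k × Fin k → Vec (Fin k) 9
    u (a , b) = (v [ i ]≔ a) [ j ]≔ b
    injective : ∀ {x y} → kind (u x) ≡ (i , j) → kind (u y) ≡ (i , j) → code (u x) ≡ code (u y) → x ≡ y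
    injective {x} {y} p q e with critical-of-kind p | subst (CriticalAt thrifty (u y) (i , j)) (sym e) (critical-of-kind q)
    ... | i≢j , C | _ , D with critical-agree thrifty C D
                                 (λ c c≢i c≢j → trans (lookup-update₂′ v c≢i c≢j) (sym (lookup-update₂′ v c≢i c≢j)))
    ...   | eᵢ , eⱼ = cong₂ _,_
              (trans (sym (lookup-update₂ˡ v i≢j)) (trans eᵢ (lookup-update₂ˡ v i≢j)))
              (trans (sym (lookup∘update j (v [ i ]≔ _) _)) (trans eⱼ (lookup∘update j (v [ i ]≔ _) _)))

  -- Summing `count-fibre` over all `v` meets each vector `k * k` times.
  count-kind : ∀ i j → k * k * ∑ (vecs k 9) (λ v → ind (kind? (i , j) v)) ≤ k * (4 * ∑ (vecs k 9) asked)
  count-kind i j = begin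
    k * k * ∑ (vecs k 9) (λ v → ind (kind? (i , j) v))     ≡⟨ ∑-update₂ i j (λ v → ind (kind? (i , j) v)) ⟨
    ∑ (vecs k 9) (λ v → ∑ (allFin k) (λ a → ∑ (allFin k) (λ b → ind (kind? (i , j) ((v [ i ]≔ a) [ j ]≔ b)))))
                                                           ≤⟨ ∑-mono (vecs k 9) (count-fibre i j) ⟩
    ∑ (vecs k 9) (λ v → k * ∑ (allFin n) (weight v))       ≡⟨ ∑-*ˡ k (vecs k 9) _ ⟩
    k * ∑ (vecs k 9) (λ v → ∑ (allFin n) (weight v))       ≤⟨ *-monoʳ-≤ k (∑-mono (vecs k 9) ∑-weight) ⟩
    k * ∑ (vecs k 9) (λ v → 4 * asked v)                   ≡⟨ cong (k *_) (∑-*ˡ 4 (vecs k 9) asked) ⟩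
    k * (4 * ∑ (vecs k 9) asked)                           ∎
    where open ≤-Reasoning

  -- The kinds cover all `k ^ 9` vectors, so `count-kind` bounds `k ^ 9` by the total of `asked`,
  -- and `∑-asked` bounds that total through `n`; the common factor `k * k ^ 9` cancels.
  k³≤324n : .⦃ NonZero k ⦄ → k ^ 3 ≤ 324 * n
  k³≤324n ⦃ k≢0 ⦄ = *-cancelʳ-≤ (k ^ 3) (324 * n) (k * k ^ 9) ⦃ m*n≢0 k (k ^ 9) ⦃ k≢0 ⦄ ⦃ m^n≢0 k 9 ⦄ ⦄
    (cancel-powers k n (∑ (vecs k 9) asked) (k ^ 9)
      (subst (λ z → k * k * z ≤ 81 * (k * (4 * ∑ (vecs k 9) asked))) (length-vecs k 9)
        (count-cover (≡-dec _≟_ _≟_) (vecs k 9) (cartesianProduct (allFin 9) (allFin 9)) kind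
          (λ v → ∈-cartesianProduct⁺ (∈-allFin (proj₁ (kind v))) (∈-allFin (proj₂ (kind v))))
          (k * k) _ (λ (i , j) → count-kind i j)))
      ∑-asked)

theorem5p12 : Σ ℕ λ c → Σ ℕ λ k₀ →
    ∀ (k : ℕ) → k₀ ≤ k → ∀ (n : ℕ) (P : NBP k n) →
    Computes P (BT k) → Thrifty P → k ^ 3 ≤ c * n
-- The constant is 81 times 4; from `k = 2` on, the root value can be switched to flip the answer.
theorem5p12 = 324 , 2 , bound
  where
  bound : ∀ k → 2 ≤ k → ∀ n (P : NBP k n) → Computes P (BT k) → Thrifty P → k ^ 3 ≤ 324 * n
  bound (suc (suc _)) (s≤s (s≤s _)) n P computes thrifty =
    k³≤324n thrifty (critical computes thrifty) (rootState computes thrifty)
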